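{- Let $n$ be a positive integer, and let $\mathbf{CG}(n)$ and $\mathbf{CG}'(n)$ be the claw graph and its companion. Then $\mathbf{CG}(n)$ and $\mathbf{CG}'(n)$ are TF-cousins if and only if $n$ is odd.
   Context: An undirected edge $\{u,v\}$ is treated as the union of the two arcs $(u,v)$ and $(v,u)$. For graphs $G,H$, a TF-isomorphism (two-fold isomorphism) from $G$ to $H$ is a pair $(\alpha,\beta)$ of bijections $V(G)\to V(H)$ such that, for all $u,v\in V(G)$, $(u,v)$ is an arc of $G$ if and only if $(\alpha(u),\beta(v))$ is an arc of $H$. Graphs $G,H$ are TF-isomorphic if such a pair exists. Two graphs are TF-cousins if they are TF-isomorphic and not isomorphic. For a positive integer $n$, the claw graph $\mathbf{CG}(n)$ is the simple undirected graph on $10n$ vertices defined as follows. Its vertices are circuit vertices $u_0,\dots,u_{6n-1}$, centres $c_i$ for $0\le i<n$, and leaves $\ell_{i,j}$ for $0\le i<n$, $j\in\{0,1,2\}$. Its edges are: - circuit edges $\{u_m,u_{m+1}\}$ for $0\le m<6n$ (indices modulo $6n$), forming a cycle $C_{6n}$; - $\{c_i,\ell_{i,j}\}$ for all $i,j$; - $\{\ell_{i,j},u_{i+jn}\}$ and $\{\ell_{i,j},u_{i+jn+3n}\}$ for all $i,j$ (indices modulo $6n$). The companion $\mathbf{CG}'(n)$ has the same vertices and the same edges, except that the cycle $C_{6n}$ is replaced by two disjoint cycles $C_{3n}$: one on $u_0,u_1,\dots,u_{3n-1}$ (in this cyclic order) and one on $u_{3n},u_{3n+1},\dots,u_{6n-1}$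 (in this cyclic order). -}

module Defs where

open import Data.Fin using (Fin; toℕ)
open import Data.Fin.Properties using (toℕ-fromℕ<)
open import Data.Nat using (ℕ; suc; _+_; _*_; _<_; _%_; NonZero; s≤s; z≤n; >-nonZero⁻¹)
open import Data.Nat.DivMod using (_mod_; m%n<n; m<n⇒m%n≡m; n%n≡0)
open import Data.Nat.Properties using (m*n≢0; *-mono-≤; m≤n⇒m<n∨m≡n; 1+n≢n; <-irrefl; <-≤-trans; *-monoˡ-≤; +-monoʳ-<; ≤-reflexive; *-distribʳ-+; +-cancelˡ-≡)
open import Data.Product using (Σ-syntax; _×_)
open import Data.Sum using (inj₁; inj₂)
open import Function.Bundles using (_⤖_; _⇔_; module Bijection)
open import Level using (0ℓ)
open import Relation.Binary using (Rel; Symmetric; Irreflexive)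
open import Relation.Binary.Construct.Closure.Symmetric using (SymClosure; fwd; bwd; symmetric)
open import Relation.Binary.PropositionalEquality using (_≡_; refl; sym; trans; cong)
open import Relation.Nullary using (¬_)

-- Simple undirected graphs.  An edge {u , v} is the pair of arcs
-- (u , v), (v , u), so `Arc` is a symmetric irreflexive relation.
record Graph : Set₁ where
  field
    Vertex     : Set
    Arc        : Rel Vertex 0ℓ
    arc-sym    : Symmetric Arc
    arc-irrefl : Irreflexive _≡_ Arc

open Graph using (Vertex; Arc)

Isomorphic : Graph → Graph → Set
Isomorphic G H =
  Σ[ φ ∈ (Vertex G ⤖ Vertex H) ]
    (∀ u v → Arc G u v ⇔ Arc H (Bijection.to φ u) (Bijection.to φ v))

TFIsomorphic : Graph → Graph → Set
TFIsomorphic G H =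
  Σ[ α ∈ (Vertex G ⤖ Vertex H) ] Σ[ β ∈ (Vertex G ⤖ Vertex H) ]
    (∀ u v → Arc G u v ⇔ Arc H (Bijection.to α u) (Bijection.to β v))

TFCousins : Graph → Graph → Set
TFCousins G H = TFIsomorphic G H × ¬ Isomorphic G H

data ClawVertex (n : ℕ) : Set where
  circuit : Fin (6 * n) → ClawVertex n
  centre  : Fin n → ClawVertex n
  leaf    : Fin n → Fin 3 → ClawVertex n

module _ (n : ℕ) .{{_ : NonZero n}} where

  private instance
    3n≢0 : NonZero (3 * n)
    3n≢0 = m*n≢0 3 n

    6n≢0 : NonZero (6 * n)
    6n≢0 = m*n≢0 6 n

  ix : ℕ → Fin (6 * n)
  ix m = m mod (6 * n)

  data OneCycle : Rel (Fin (6 * n)) 0ℓ where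
    step : ∀ m → m < 6 * n → OneCycle (ix m) (ix (suc m))

  -- Inside each 3n-cycle, positions are taken modulo 3n; the outer `ix` only
  -- turns a number already below 6n into an element of Fin (6 * n).
  data TwoCycles : Rel (Fin (6 * n)) 0ℓ where
    step₁ : ∀ m → m < 3 * n →
            TwoCycles (ix m) (ix (suc m % (3 * n)))
    step₂ : ∀ m → m < 3 * n →
            TwoCycles (ix (3 * n + m)) (ix (3 * n + suc m % (3 * n)))

  -- One orientation of each edge, for a given set C of circuit edges.
  data ClawEdge (C : Rel (Fin (6 * n)) 0ℓ) : Rel (ClawVertex n) 0ℓ where
    circuit-circuit : ∀ {x y} → C x y → ClawEdge C (circuit x) (circuit y)
    centre-leaf     : ∀ i j → ClawEdge C (centre i) (leaf i j)
    leaf-circuit    : ∀ i j →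
      ClawEdge C (leaf i j) (circuit (ix (toℕ i + toℕ j * n)))
    leaf-circuit′   : ∀ i j →
      ClawEdge C (leaf i j) (circuit (ix (toℕ i + toℕ j * n + 3 * n)))

  private
    1<6n : 1 < 6 * n
    1<6n = *-mono-≤ {2} {6} {1} {n} (s≤s (s≤s z≤n)) (>-nonZero⁻¹ n)

    1<3n : 1 < 3 * n
    1<3n = *-mono-≤ {2} {3} {1} {n} (s≤s (s≤s z≤n)) (>-nonZero⁻¹ n)

    suc%≢ : ∀ k .{{_ : NonZero k}} → 1 < k → ∀ m → m < k → ¬ m ≡ suc m % k
    suc%≢ k 1<k m m<k eq with m≤n⇒m<n∨m≡n m<k
    ... | inj₁ lt = 1+n≢n (sym (trans eq (m<n⇒m%n≡m lt)))
    ... | inj₂ refl with trans eq (n%n≡0 (suc m))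
    ...   | refl = <-irrefl refl 1<k

    ix-inj : ∀ {a b} → ix a ≡ ix b → a % (6 * n) ≡ b % (6 * n)
    ix-inj {a} {b} eq = trans (sym (toℕ-fromℕ< (m%n<n a (6 * n))))
      (trans (cong toℕ eq) (toℕ-fromℕ< (m%n<n b (6 * n))))

    ix-inj< : ∀ {a b} → a < 6 * n → b < 6 * n → ix a ≡ ix b → a ≡ b
    ix-inj< {a} {b} a< b< eq =
      trans (sym (m<n⇒m%n≡m a<)) (trans (ix-inj {a} {b} eq) (m<n⇒m%n≡m b<))

    lo : ∀ {a} → a < 3 * n → a < 6 * n
    lo a< = <-≤-trans a< (*-monoˡ-≤ n {3} {6} (s≤s (s≤s (s≤s z≤n))))

    hi : ∀ {a} → a < 3 * n → 3 * n + a < 6 * n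
    hi a< = <-≤-trans (+-monoʳ-< (3 * n) a<) (≤-reflexive (sym (*-distribʳ-+ n 3 3)))

    oneCycle-irrefl : Irreflexive _≡_ OneCycle
    oneCycle-irrefl eq (step m m<) =
      suc%≢ (6 * n) 1<6n m m<
        (trans (sym (m<n⇒m%n≡m m<)) (ix-inj {m} {suc m} eq))

    twoCycles-irrefl : Irreflexive _≡_ TwoCycles
    twoCycles-irrefl eq (step₁ m m<) = suc%≢ (3 * n) 1<3n m m<
      (ix-inj< (lo m<) (lo (m%n<n (suc m) (3 * n))) eq)
    twoCycles-irrefl eq (step₂ m m<) = suc%≢ (3 * n) 1<3n m m<
      (+-cancelˡ-≡ (3 * n) _ _
        (ix-inj< (hi m<) (hi (m%n<n (suc m) (3 * n))) eq))

    clawEdge-irrefl : ∀ {C} → Irreflexive _≡_ C → Irreflexive _≡_ (ClawEdge C)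
    clawEdge-irrefl irr refl (circuit-circuit c) = irr refl c

  clawGraph : (C : Rel (Fin (6 * n)) 0ℓ) → Irreflexive _≡_ C → Graph
  clawGraph C irr = record
    { Vertex     = ClawVertex n
    ; Arc        = SymClosure (ClawEdge C)
    ; arc-sym    = symmetric (ClawEdge C)
    ; arc-irrefl = λ { eq (fwd e) → clawEdge-irrefl irr eq e
                     ; eq (bwd e) → clawEdge-irrefl irr (sym eq) e }
    }

  CG : Graph
  CG = clawGraph OneCycle oneCycle-irrefl

  CG′ : Graph
  CG′ = clawGraph TwoCycles twoCycles-irrefl

{-# OPTIONS --safe #-}
module Submission where

-- For n odd, Z/6n ≅ Z/3n × Z/2, so sending u_m to the vertex at position m mod 3n on the side
-- given by the parity of m, respectively of m + 1, and fixing leaves and centres, is a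
-- TF-isomorphism.  The graphs are not isomorphic.  For n = 1, CG′ has a triangle and CG has
-- none.  For n ≥ 3 the centres are the vertices on no 6-cycle: this holds in CG, and the part
-- needed for CG′ follows because TF-isomorphisms preserve closed walks of even length.  An
-- isomorphism therefore maps circuit vertices to circuit vertices, but a 6n-cycle does not embed
-- into two 3n-cycles.
-- For n even both graphs are bipartite and CG is connected, so a TF-isomorphism can be
-- recombined along the colour classes into an isomorphism.

open import Defs
open import Data.Empty using (⊥; ⊥-elim)
open import Data.Fin using (Fin; zero; suc; toℕ; fromℕ<; combine; remQuot; #_)
open import Data.Fin.Properties
  using (toℕ<n; toℕ-injective; toℕ-fromℕ<; toℕ-combine; combine-remQuot;
         combine-injectiveˡ; combine-injectiveʳ; pigeonhole; <⇒≢)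
open import Data.Nat
  using (ℕ; zero; suc; pred; _+_; _*_; _<_; _≤_; _%_; _/_; z≤n; s≤s; NonZero; >-nonZero⁻¹; parity)
open import Data.Nat.DivMod
open import Data.Nat.Divisibility
  using (_∣_; _∤_; divides; divides-refl; ∣m+n∣m⇒∣n; >⇒∤; n∣m*n)
open import Data.Nat.Properties hiding (<⇒≢)
open import Data.Nat.Tactic.RingSolver using (solve-∀)
open import Data.Parity as ℙ using (Parity; 0ℙ; 1ℙ; _⁻¹)
import Data.Parity.Properties as ℙₚ
open import Data.Product using (∃-syntax; _,_; proj₁; proj₂; uncurry)
open import Data.Sum using (_⊎_; inj₁; inj₂)
open import Data.Unit using (⊤; tt)
open import Function.Base using (_∘_; case_of_)
open import Function.Bundles using (_⤖_; _⇔_; mk⇔; mk⤖; module Bijection; module Equivalence)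
open import Function.Consequences.Propositional using (strictlySurjective⇒surjective)
open import Relation.Binary using (Rel)
open import Relation.Binary.Construct.Closure.Symmetric using (SymClosure; fwd; bwd)
open import Relation.Binary.PropositionalEquality
open import Relation.Nullary using (¬_; yes; no; contradiction)
open import Level using (0ℓ)

open Graph using (Vertex; Arc; arc-sym)
open Bijection using (to; injective; strictlySurjective)

private variable
  G H : Graph

-- Two-fold isomorphisms between bipartite graphs

IsColouring : (G : Graph) → (Vertex G → Parity) → Set
IsColouring G c = ∀ {u v} → Arc G u v → c v ≡ c u ⁻¹

-- Connectedness, in the form: every 2-valued function constant along arcs is constant.
Connected : Graph → Set
Connected G = ∀ (f : Vertex G → Parity) → (∀ {u v} → Arc G u v → f u ≡ f v) → ∀ u v → f u ≡ f v

pick : {A : Set} → Parity → A → A → A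
pick 0ℙ a b = a
pick 1ℙ a b = b

module Interleave
  {G H : Graph} {c : Vertex G → Parity} (c-col : IsColouring G c)
  (α β : Vertex G → Vertex H)
  (arc : ∀ {u v} → Arc G u v → Arc H (α u) (β v))
  where

  φ : Vertex G → Vertex H
  φ u = pick (c u) (α u) (β u)

  -- An arc joins opposite colours, so one end moves by `α` and the other by `β`. If the first end
  -- has colour `1ℙ`, the arc is reversed before and after `arc` applies.
  φ-arc : ∀ {u v} → Arc G u v → Arc H (φ u) (φ v)
  φ-arc {u} {v} a with c u | c v | c-col a
  ... | 0ℙ | _ | refl = arc a
  ... | 1ℙ | _ | refl = arc-sym H (arc (arc-sym G a))

  module _ {h : Vertex H → Parity} (h-col : IsColouring H h) (conn : Connected G) where

    -- Both colours flip along every arc, so their sum is constant along arcs, and connectedness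
    -- spreads it to all vertices.
    shift-constant : ∀ u v → c u ℙ.+ h (φ u) ≡ c v ℙ.+ h (φ v)
    shift-constant = conn (λ u → c u ℙ.+ h (φ u)) λ {u} {v} a →
      trans (flip-both (c u) (h (φ u))) (sym (cong₂ ℙ._+_ (c-col a) (h-col (φ-arc a))))
      where
      flip-both : ∀ p q → p ℙ.+ q ≡ p ⁻¹ ℙ.+ q ⁻¹
      flip-both 0ℙ 0ℙ = refl
      flip-both 0ℙ 1ℙ = refl
      flip-both 1ℙ 0ℙ = refl
      flip-both 1ℙ 1ℙ = refl

-- The isomorphism follows α on one colour class and β on the other.
bipartite-TF⇒iso : {c : Vertex G → Parity} {h : Vertex H → Parity} →
  IsColouring G c → IsColouring H h → Connected G → (∃[ u ] ∃[ v ] Arc G u v) →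
  TFIsomorphic G H → Isomorphic G H
bipartite-TF⇒iso {G} {H} {c} {h} c-col h-col conn (u₀ , v₀ , arc₀) (α , β , arcs) =
  mk⤖ (φ-injective , strictlySurjective⇒surjective φ-surjective) ,
  λ u v → mk⇔ I.φ-arc (φ-arc⁻ u v)
  where
  to-arc : ∀ {u v} → Arc G u v → Arc H (to α u) (to β v)
  to-arc = Equivalence.to (arcs _ _)

  to-arc′ : ∀ {u v} → Arc G u v → Arc H (to β u) (to α v)
  to-arc′ = arc-sym H ∘ to-arc ∘ arc-sym G

  -- The isomorphism is `I.φ`. The interleaving `J.φ` takes the other of the two values at each
  -- vertex, and its colour shift is what surjectivity of `I.φ` rests on.
  module I = Interleave {G} {H} c-col (to α) (to β) to-arc
  module J = Interleave {G} {H} c-col (to β) (to α) to-arc′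

  k l : Parity
  k = c u₀ ℙ.+ h (I.φ u₀)
  l = c u₀ ℙ.+ h (J.φ u₀)

  solve-h : ∀ p {q r} → p ℙ.+ q ≡ r → q ≡ p ℙ.+ r
  solve-h 0ℙ refl = refl
  solve-h 1ℙ refl = sym (ℙₚ.⁻¹-involutive _)

  h-I : ∀ u → h (I.φ u) ≡ c u ℙ.+ k
  h-I u = solve-h (c u) (I.shift-constant h-col conn u u₀)

  h-J : ∀ u → h (J.φ u) ≡ c u ℙ.+ l
  h-J u = solve-h (c u) (J.shift-constant h-col conn u u₀)

  -- By `h-I` the colour of an image determines the colour of its argument, so equal images come
  -- from the same bijection.
  φ-injective : ∀ {u v} → I.φ u ≡ I.φ v → u ≡ v
  φ-injective {u} {v} eq
    with c u | c v | ℙₚ.+-cancelʳ-≡ k (c u) (c v) (trans (sym (h-I u)) (trans (cong h eq) (h-I v))) | eq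
  ... | 0ℙ | _ | refl | e = injective α e
  ... | 1ℙ | _ | refl | e = injective β e

  -- For opposite colours this reads the two-fold condition backwards. Equal colours are sent to
  -- equal colours, which no arc of `H` joins.
  φ-arc⁻ : ∀ u v → Arc H (I.φ u) (I.φ v) → Arc G u v
  φ-arc⁻ u v a with c u | c v | h-I u | h-I v | a
  ... | 0ℙ | 1ℙ | _ | _ | a′ = Equivalence.from (arcs u v) a′
  ... | 1ℙ | 0ℙ | _ | _ | a′ = arc-sym G (Equivalence.from (arcs v u) (arc-sym H a′))
  ... | 0ℙ | 0ℙ | e | e′ | a′ = contradiction (trans e (trans (sym e′) (h-col a′))) (ℙₚ.p≢p⁻¹ _)
  ... | 1ℙ | 1ℙ | e | e′ | a′ = contradiction (trans e (trans (sym e′) (h-col a′))) (ℙₚ.p≢p⁻¹ _)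

  -- Otherwise α would send every vertex to the same colour class.
  k≡l : k ≡ l
  k≡l with ℙₚ._≟_ k l
  ... | yes e = e
  ... | no k≢l = contradiction (trans (h≡k _) (sym (h≡k _))) (λ e → ℙₚ.p≢p⁻¹ _ (trans e (h-col (I.φ-arc arc₀))))
    where
    flips : ∀ p q → p ≢ q → 1ℙ ℙ.+ q ≡ p
    flips 0ℙ 0ℙ ne = contradiction refl ne
    flips 0ℙ 1ℙ ne = refl
    flips 1ℙ 0ℙ ne = refl
    flips 1ℙ 1ℙ ne = contradiction refl ne

    h-α : ∀ u → h (to α u) ≡ k
    h-α u with c u | h-I u | h-J u
    ... | 0ℙ | e | _ = e
    ... | 1ℙ | _ | e = trans e (flips k l k≢l)

    h≡k : ∀ y → h y ≡ k
    h≡k y with u , refl ← strictlySurjective α y = h-α u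

  -- Take preimages `u` under `α` and `v` under `β`. One of them serves unless `u` has colour `1ℙ`
  -- and `v` has colour `0ℙ`; then `J.φ` sends both to `y`, and its colour shift gives `y` two
  -- different colours.
  φ-surjective : ∀ y → ∃[ u ] I.φ u ≡ y
  φ-surjective y with u , refl ← strictlySurjective α y | v , eq ← strictlySurjective β y
    with c u in cu | c v in cv | h-I u | h-J u | h-J v
  ... | 0ℙ | _ | _ | _ | _ = u , cong (λ p → pick p (to α u) (to β u)) cu
  ... | 1ℙ | 1ℙ | _ | _ | _ = v , trans (cong (λ p → pick p (to α v) (to β v)) cv) eq
  ... | 1ℙ | 0ℙ | _ | e | e′ =
    contradiction (trans (sym e′) (trans (cong h eq) e)) (ℙₚ.p≢p⁻¹ l)

-- Hexagons and triangles in a graph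

-- Of the conditions making the closed walk w₀ w₁ … w₅ a 6-cycle, only the disequalities that
-- exclude centres are kept.
record Hexagon (G : Graph) (w₀ : Vertex G) : Set where
  field
    {w₁ w₂ w₃ w₄ w₅} : Vertex G
    arc₀₁ : Arc G w₀ w₁
    arc₁₂ : Arc G w₁ w₂
    arc₂₃ : Arc G w₂ w₃
    arc₃₄ : Arc G w₃ w₄
    arc₄₅ : Arc G w₄ w₅
    arc₅₀ : Arc G w₅ w₀
    w₀≢w₂ : w₀ ≢ w₂
    w₀≢w₄ : w₀ ≢ w₄
    w₁≢w₃ : w₁ ≢ w₃
    w₂≢w₄ : w₂ ≢ w₄

-- An even closed walk is sent to a closed walk by applying A and B alternately.
hexagon-map : (A B : Vertex G → Vertex H) →
  (∀ {u v} → A u ≡ A v → u ≡ v) → (∀ {u v} → B u ≡ B v → u ≡ v) →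
  (∀ {u v} → Arc G u v → Arc H (A u) (B v)) →
  ∀ {w} → Hexagon G w → Hexagon H (A w)
hexagon-map {G} {H} A B A-inj B-inj arc hex = record
  { arc₀₁ = arc arc₀₁ ; arc₁₂ = arc′ arc₁₂ ; arc₂₃ = arc arc₂₃
  ; arc₃₄ = arc′ arc₃₄ ; arc₄₅ = arc arc₄₅ ; arc₅₀ = arc′ arc₅₀
  ; w₀≢w₂ = w₀≢w₂ ∘ A-inj ; w₀≢w₄ = w₀≢w₄ ∘ A-inj
  ; w₁≢w₃ = w₁≢w₃ ∘ B-inj ; w₂≢w₄ = w₂≢w₄ ∘ A-inj
  }
  where
  open Hexagon hex
  arc′ : ∀ {u v} → Arc G u v → Arc H (B u) (A v)
  arc′ = arc-sym H ∘ arc ∘ arc-sym G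

circuit-injective : ∀ {n} {x y : Fin (6 * n)} → circuit {n} x ≡ circuit y → x ≡ y
circuit-injective refl = refl

TriangleFree : Graph → Set
TriangleFree G = ∀ {u v w} → Arc G u v → Arc G v w → Arc G w u → ⊥

-- Parity and remainders

parity-suc : ∀ m → parity (suc m) ≡ parity m ⁻¹
parity-suc m = ℙₚ.+-homo-+ 1 m

parity-0⇒2∣ : ∀ m → parity m ≡ 0ℙ → 2 ∣ m
parity-0⇒2∣ zero    _ = divides 0 refl
parity-0⇒2∣ (suc (suc m)) eq with divides q refl ← parity-0⇒2∣ m eq = divides (suc q) refl

2∣⇒parity-0 : ∀ {m} → 2 ∣ m → parity m ≡ 0ℙ
2∣⇒parity-0 (divides-refl q) = trans (ℙₚ.*-homo-* q 2) (ℙₚ.*-zeroʳ (parity q))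

2∤⇒parity-1 : ∀ {m} → 2 ∤ m → parity m ≡ 1ℙ
2∤⇒parity-1 {m} 2∤m with parity m in eq
... | 0ℙ = contradiction (parity-0⇒2∣ m eq) 2∤m
... | 1ℙ = refl

parity-+s*even : ∀ k s {d} → parity d ≡ 0ℙ → parity (k + s * d) ≡ parity k
parity-+s*even k s {d} d-even = begin
  parity (k + s * d)                     ≡⟨ ℙₚ.+-homo-+ k (s * d) ⟩
  parity k ℙ.+ parity (s * d)            ≡⟨ cong (parity k ℙ.+_) (ℙₚ.*-homo-* s d) ⟩
  parity k ℙ.+ (parity s ℙ.* parity d)   ≡⟨ cong (λ p → parity k ℙ.+ (parity s ℙ.* p)) d-even ⟩
  parity k ℙ.+ (parity s ℙ.* 0ℙ)         ≡⟨ cong (parity k ℙ.+_) (ℙₚ.*-zeroʳ (parity s)) ⟩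
  parity k ℙ.+ 0ℙ                        ≡⟨ ℙₚ.+-identityʳ (parity k) ⟩
  parity k                               ∎
  where open ≡-Reasoning

parity-% : ∀ m {d} .{{_ : NonZero d}} → parity d ≡ 0ℙ → parity (m % d) ≡ parity m
parity-% m {d} d-even = sym
  (trans (cong parity (m≡m%n+[m/n]*n m d)) (parity-+s*even (m % d) (m / d) {d} d-even))

%-absorbʳ : ∀ k m d .{{_ : NonZero d}} → (k + m % d) % d ≡ (k + m) % d
%-absorbʳ k m d = begin
  (k + m % d) % d          ≡⟨ %-distribˡ-+ k (m % d) d ⟩
  (k % d + m % d % d) % d  ≡⟨ cong (λ r → (k % d + r) % d) (m%n%n≡m%n m d) ⟩
  (k % d + m % d) % d      ≡⟨ %-distribˡ-+ k m d ⟨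
  (k + m) % d              ∎
  where open ≡-Reasoning

-- Together with `>⇒∤`, this shows that a shift by `k` with `0 < k < d` changes every residue; the
-- disequalities of positions below come from it.
[k+m]%d≡m%d⇒d∣k : ∀ k m d .{{_ : NonZero d}} → (k + m) % d ≡ m % d → d ∣ k
[k+m]%d≡m%d⇒d∣k k m d eq = ∣m+n∣m⇒∣n (divides ((k + m) / d) multiples) (n∣m*n (m / d))
  where
  open ≡-Reasoning
  multiples : (m / d) * d + k ≡ ((k + m) / d) * d
  multiples = +-cancelˡ-≡ (m % d) _ _ (begin
    m % d + ((m / d) * d + k)          ≡⟨ +-assoc (m % d) _ k ⟨
    m % d + (m / d) * d + k            ≡⟨ cong (_+ k) (m≡m%n+[m/n]*n m d) ⟨
    m + k                              ≡⟨ +-comm m k ⟩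
    k + m                              ≡⟨ m≡m%n+[m/n]*n (k + m) d ⟩
    (k + m) % d + ((k + m) / d) * d    ≡⟨ cong (_+ ((k + m) / d) * d) eq ⟩
    m % d + ((k + m) / d) * d          ∎)

-- Circuit indices modulo 3n and 6n

module _ (n : ℕ) .{{_ : NonZero n}} where

  private
    N M : ℕ
    N = 3 * n
    M = 6 * n

    instance
      N≢0 : NonZero N
      N≢0 = m*n≢0 3 n

      M≢0 : NonZero M
      M≢0 = m*n≢0 6 n

    N+N≡M : N + N ≡ M
    N+N≡M = sym (*-distribʳ-+ n 3 3)

    N∣M : N ∣ M
    N∣M = divides 2 (sym (trans (cong (N +_) (+-identityʳ N)) N+N≡M))

    n∣N : n ∣ N
    n∣N = divides 3 refl

    M-even : parity M ≡ 0ℙ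
    M-even = ℙₚ.*-homo-* 6 n

    1<N : 1 < N
    1<N = *-mono-≤ {2} {3} {1} {n} (s≤s (s≤s z≤n)) (>-nonZero⁻¹ n)

    N<M : N < M
    N<M = subst (N <_) N+N≡M (m<m+n N (>-nonZero⁻¹ N))

    [k+sN]%N≡k : ∀ {k} s → k < N → (k + s * N) % N ≡ k
    [k+sN]%N≡k {k} s k<N = trans ([m+kn]%n≡m%n k s N) (m<n⇒m%n≡m k<N)

  toℕ-ix : ∀ m → toℕ (ix n m) ≡ m % M
  toℕ-ix m = toℕ-fromℕ< (m%n<n m M)

  ix-cong : ∀ {a b} → a % M ≡ b % M → ix n a ≡ ix n b
  ix-cong {a} {b} eq = toℕ-injective (trans (toℕ-ix a) (trans eq (sym (toℕ-ix b))))

  ix-toℕ : ∀ x → ix n (toℕ x) ≡ x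
  ix-toℕ x = toℕ-injective (trans (toℕ-ix (toℕ x)) (m<n⇒m%n≡m (toℕ<n x)))

  toℕ-ix-%N : ∀ m → toℕ (ix n m) % N ≡ m % N
  toℕ-ix-%N m = trans (cong (_% N) (toℕ-ix m)) (m∣n⇒o%n%m≡o%m N M m N∣M)

  parity-ix : ∀ m → parity (toℕ (ix n m)) ≡ parity m
  parity-ix m = trans (cong parity (toℕ-ix m)) (parity-% m {M} M-even)

  -- For k < N, ix n (k + s * N) is the vertex at position k on side s; only the parity of s matters.
  ix-2+ : ∀ k a → ix n (k + (2 + a) * N) ≡ ix n (k + a * N)
  ix-2+ k a = ix-cong (begin
    (k + (N + (N + a * N))) % M   ≡⟨ cong (_% M) (shuffle k N (a * N)) ⟩
    ((k + a * N) + (N + N)) % M   ≡⟨ cong (λ d → ((k + a * N) + d) % M) N+N≡M ⟩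
    ((k + a * N) + M) % M         ≡⟨ [m+n]%n≡m%n (k + a * N) M ⟩
    (k + a * N) % M               ∎)
    where
    open ≡-Reasoning
    shuffle : ∀ x y z → x + (y + (y + z)) ≡ (x + z) + (y + y)
    shuffle = solve-∀

  ix-side : ∀ k a b → parity a ≡ parity b → ix n (k + a * N) ≡ ix n (k + b * N)
  ix-side k 0             0             _  = refl
  ix-side k 1             1             _  = refl
  ix-side k (suc (suc a)) b             eq = trans (ix-2+ k a) (ix-side k a b eq)
  ix-side k 0             (suc (suc b)) eq = trans (ix-side k 0 b eq) (sym (ix-2+ k b))
  ix-side k 1             (suc (suc b)) eq = trans (ix-side k 1 b eq) (sym (ix-2+ k b))

  -- Steps along the long cycle and along the two short cycles

  next : Fin M → Fin M
  next x = ix n (suc (toℕ x))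

  -- Adding `pred M` subtracts one modulo `M`, including at index 0.
  prev : Fin M → Fin M
  prev x = ix n (pred M + toℕ x)

  next-ix : ∀ m → next (ix n m) ≡ ix n (suc m)
  next-ix m = ix-cong (trans (cong (λ r → suc r % M) (toℕ-ix m)) (%-absorbʳ 1 m M))

  prev-next : ∀ x → prev (next x) ≡ x
  prev-next x = trans (ix-cong (begin
    (pred M + toℕ (next x)) % M    ≡⟨ cong (λ r → (pred M + r) % M) (toℕ-ix (suc (toℕ x))) ⟩
    (pred M + suc (toℕ x) % M) % M ≡⟨ %-absorbʳ (pred M) (suc (toℕ x)) M ⟩
    (pred M + suc (toℕ x)) % M     ≡⟨ cong (_% M) (+-suc (pred M) (toℕ x)) ⟩
    (suc (pred M) + toℕ x) % M     ≡⟨ cong (λ d → (d + toℕ x) % M) (suc-pred M) ⟩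
    (M + toℕ x) % M                ≡⟨ cong (_% M) (+-comm M (toℕ x)) ⟩
    (toℕ x + M) % M                ≡⟨ [m+n]%n≡m%n (toℕ x) M ⟩
    toℕ x % M                      ∎)) (ix-toℕ x)
    where open ≡-Reasoning

  next-injective : ∀ {x y} → next x ≡ next y → x ≡ y
  next-injective {x} {y} eq = trans (sym (prev-next x)) (trans (cong prev eq) (prev-next y))

  -- Reducing `m` first removes the bound in `step`, so walks may pass index `M` without a case
  -- distinction.
  oneCycle-step : ∀ m → OneCycle n (ix n m) (ix n (suc m))
  oneCycle-step m = subst₂ (OneCycle n)
    (ix-cong (m%n%n≡m%n m M)) (ix-cong (%-absorbʳ 1 m M)) (step (m % M) (m%n<n m M))

  oneCycle⇒next : ∀ {x y} → OneCycle n x y → y ≡ next x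
  oneCycle⇒next (step m _) = sym (next-ix m)

  parity-next : ∀ x → parity (toℕ (next x)) ≡ parity (toℕ x) ⁻¹
  parity-next x = trans (parity-ix (suc (toℕ x))) (parity-suc (toℕ x))

  next-%N : ∀ x → toℕ (next x) % N ≡ suc (toℕ x) % N
  next-%N x = toℕ-ix-%N (suc (toℕ x))

  -- The side `s` is left unbounded because the twist below produces sides of any size.
  twoCycles-step : ∀ k s → k < N → TwoCycles n (ix n (k + s * N)) (ix n (suc k % N + s * N))
  twoCycles-step k zero k<N = subst₂ (TwoCycles n)
    (cong (ix n) (sym (+-identityʳ k))) (cong (ix n) (sym (+-identityʳ (suc k % N)))) (step₁ k k<N)
  twoCycles-step k 1 k<N = subst₂ (TwoCycles n)
    (cong (ix n) (flip k)) (cong (ix n) (flip (suc k % N))) (step₂ k k<N)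
    where
    flip : ∀ a → N + a ≡ a + 1 * N
    flip a = trans (+-comm N a) (cong (a +_) (sym (*-identityˡ N)))
  twoCycles-step k (suc (suc s)) k<N = subst₂ (TwoCycles n)
    (sym (ix-2+ k s)) (sym (ix-2+ (suc k % N) s)) (twoCycles-step k s k<N)

  -- Both constructors of `TwoCycles` in one formula. The bound `s < 2` makes `s` the true side
  -- rather than a representative of its parity.
  data TwoCyclesView : Fin M → Fin M → Set where
    view : ∀ k s → k < N → s < 2 → TwoCyclesView (ix n (k + s * N)) (ix n (suc k % N + s * N))

  twoCycles-view : ∀ {x y} → TwoCycles n x y → TwoCyclesView x y
  twoCycles-view (step₁ m m<N) = subst₂ TwoCyclesView
    (cong (ix n) (+-identityʳ m)) (cong (ix n) (+-identityʳ (suc m % N)))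
    (view m 0 m<N (s≤s z≤n))
  twoCycles-view (step₂ m m<N) = subst₂ TwoCyclesView
    (cong (ix n) (flip m)) (cong (ix n) (flip (suc m % N)))
    (view m 1 m<N (s≤s (s≤s z≤n)))
    where
    flip : ∀ a → a + 1 * N ≡ N + a
    flip a = trans (cong (a +_) (*-identityˡ N)) (+-comm a N)

  side : Fin M → ℕ
  side x = toℕ x / N

  -- Both ends have the form `a + s * N` with `a < N` and `s < 2`. Such a number is below `M`, so
  -- `ix` does not wrap it and division by `N` returns `s`.
  twoCycles-side : ∀ {x y} → TwoCycles n x y → side x ≡ side y
  twoCycles-side c with view k s k<N s<2 ← twoCycles-view c =
    trans (side≡s k k<N) (sym (side≡s (suc k % N) (m%n<n (suc k) N)))
    where
    open ≡-Reasoning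
    bound : ∀ a → a < N → a + s * N < M
    bound a a<N = subst (a + s * N <_) (trans (cong (N +_) (*-identityˡ N)) N+N≡M)
      (+-mono-<-≤ a<N (*-monoˡ-≤ N (≤-pred s<2)))

    side≡s : ∀ a → a < N → side (ix n (a + s * N)) ≡ s
    side≡s a a<N = begin
      toℕ (ix n (a + s * N)) / N  ≡⟨ cong (_/ N) (toℕ-ix (a + s * N)) ⟩
      (a + s * N) % M / N         ≡⟨ cong (_/ N) (m<n⇒m%n≡m (bound a a<N)) ⟩
      (a + s * N) / N             ≡⟨ +-distrib-/-∣ʳ a {d = N} (divides s refl) ⟩
      a / N + s * N / N           ≡⟨ cong₂ _+_ (m<n⇒m/n≡0 a<N) (m*n/n≡m s N) ⟩
      s                           ∎

  -- Positions of the leaves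

  position : Fin n → Fin 3 → ℕ
  position i j = toℕ i + toℕ j * n

  -- Identifies positions with the bijection between `Fin 3 × Fin n` and `Fin (3 * n)`, which then
  -- supplies their bound, injectivity and surjectivity.
  position-combine : ∀ i j → position i j ≡ toℕ (combine j i)
  position-combine i j = sym (begin
    toℕ (combine j i)    ≡⟨ toℕ-combine j i ⟩
    n * toℕ j + toℕ i    ≡⟨ +-comm (n * toℕ j) (toℕ i) ⟩
    toℕ i + n * toℕ j    ≡⟨ cong (toℕ i +_) (*-comm n (toℕ j)) ⟩
    toℕ i + toℕ j * n    ∎)
    where open ≡-Reasoning

  position<N : ∀ i j → position i j < N
  position<N i j = subst (_< N) (sym (position-combine i j)) (toℕ<n (combine j i))

  position-injective : ∀ {i i′ j j′} → position i j ≡ position i′ j′ → leaf {n} i j ≡ leaf i′ j′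
  position-injective {i} {i′} {j} {j′} eq =
    cong₂ leaf (combine-injectiveʳ j i j′ i′ same) (combine-injectiveˡ j i j′ i′ same)
    where
    same : combine j i ≡ combine j′ i′
    same = toℕ-injective
      (trans (sym (position-combine i j)) (trans eq (position-combine i′ j′)))

  position-surjective : ∀ k → k < N → ∃[ i ] ∃[ j ] position i j ≡ k
  position-surjective k k<N with remQuot {3} n (fromℕ< k<N) in eq
  ... | j , i = i , j , trans (position-combine i j)
    (trans (cong toℕ (trans (cong (uncurry combine) (sym eq)) (combine-remQuot {3} n (fromℕ< k<N))))
           (toℕ-fromℕ< k<N))

  module _ {C : Rel (Fin M) 0ℓ} where

    leaf-side : ∀ i j s → ClawEdge n C (leaf i j) (circuit (ix n (position i j + s * N)))
    leaf-side i j zero = subst (λ m → ClawEdge n C (leaf i j) (circuit (ix n m)))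
      (sym (+-identityʳ _)) (leaf-circuit i j)
    leaf-side i j 1 = subst (λ m → ClawEdge n C (leaf i j) (circuit (ix n m)))
      (cong (position i j +_) (sym (*-identityˡ N))) (leaf-circuit′ i j)
    leaf-side i j (suc (suc s)) = subst (λ x → ClawEdge n C (leaf i j) (circuit x))
      (sym (ix-2+ (position i j) s)) (leaf-side i j s)

    -- The leaf is the one at position `m % N`; the quotient `m / N` is absorbed into the side.
    leaf-at : ∀ m → ∃[ i ] ∃[ j ] ∀ s → ClawEdge n C (leaf i j) (circuit (ix n (m + s * N)))
    leaf-at m with i , j , eq ← position-surjective (m % N) (m%n<n m N) =
      i , j , λ s → subst (λ a → ClawEdge n C (leaf i j) (circuit (ix n a))) (same s) (leaf-side i j (m / N + s))
      where
      open ≡-Reasoning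
      same : ∀ s → position i j + (m / N + s) * N ≡ m + s * N
      same s = begin
        position i j + (m / N + s) * N      ≡⟨ cong₂ _+_ eq (*-distribʳ-+ N (m / N) s) ⟩
        m % N + ((m / N) * N + s * N)       ≡⟨ +-assoc (m % N) _ _ ⟨
        m % N + (m / N) * N + s * N         ≡⟨ cong (_+ s * N) (m≡m%n+[m/n]*n m N) ⟨
        m + s * N                           ∎

    leaf-circuit-%N : ∀ {i j x} → ClawEdge n C (leaf i j) (circuit x) → toℕ x % N ≡ position i j
    leaf-circuit-%N (leaf-circuit i j)  = trans (toℕ-ix-%N _) (m<n⇒m%n≡m (position<N i j))
    leaf-circuit-%N (leaf-circuit′ i j) = trans (toℕ-ix-%N _)
      (trans ([m+n]%n≡m%n (position i j) N) (m<n⇒m%n≡m (position<N i j)))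

  -- The twist and the two-fold isomorphism for odd n

  -- The twist sends u_m to the copy of position m mod 3n on the side given by the parity of
  -- t + m.  Along an arc of CG both m and the index t change parity, so the side is preserved.
  twist : ℕ → Fin M → Fin M
  twist t x = ix n (toℕ x % N + (t + toℕ x) * N)

  -- Reduction modulo `M` affects neither the residue modulo `N`, as `N` divides `M`, nor the
  -- parity, as `M` is even.
  twist-ix : ∀ t m → twist t (ix n m) ≡ ix n (m % N + (t + m) * N)
  twist-ix t m = trans
    (cong (λ k → ix n (k + (t + toℕ (ix n m)) * N)) (toℕ-ix-%N m))
    (ix-side (m % N) (t + toℕ (ix n m)) (t + m) (begin
      parity (t + toℕ (ix n m))            ≡⟨ ℙₚ.+-homo-+ t _ ⟩
      parity t ℙ.+ parity (toℕ (ix n m))   ≡⟨ cong (parity t ℙ.+_) (parity-ix m) ⟩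
      parity t ℙ.+ parity m                ≡⟨ ℙₚ.+-homo-+ t m ⟨
      parity (t + m)                       ∎))
    where open ≡-Reasoning

  twist-one⇒two : ∀ t t′ → parity t′ ≡ parity (suc t) →
    ∀ {x y} → OneCycle n x y → TwoCycles n (twist t x) (twist t′ y)
  twist-one⇒two t t′ t′≡1+t (step m _) = subst₂ (TwoCycles n)
    (sym (twist-ix t m))
    (trans (cong (λ k → ix n (k + (t + m) * N)) (%-absorbʳ 1 m N))
      (trans (ix-side (suc m % N) (t + m) (t′ + suc m) sides) (sym (twist-ix t′ (suc m)))))
    (twoCycles-step (m % N) (t + m) (m%n<n m N))
    where
    open ≡-Reasoning
    sides : parity (t + m) ≡ parity (t′ + suc m)
    sides = begin
      -- `parity` discards two successors by computation; the inserted 2 is shared between `suc t`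
      -- and `suc m`.
      parity (2 + (t + m))                ≡⟨ cong parity (cong suc (sym (+-suc t m))) ⟩
      parity (suc t + suc m)              ≡⟨ ℙₚ.+-homo-+ (suc t) (suc m) ⟩
      parity (suc t) ℙ.+ parity (suc m)   ≡⟨ cong (ℙ._+ parity (suc m)) t′≡1+t ⟨
      parity t′ ℙ.+ parity (suc m)        ≡⟨ ℙₚ.+-homo-+ t′ (suc m) ⟨
      parity (t′ + suc m)                 ∎

  twistᵛ : ℕ → ClawVertex n → ClawVertex n
  twistᵛ t (circuit x) = circuit (twist t x)
  twistᵛ t (centre i)  = centre i
  twistᵛ t (leaf i j)  = leaf i j

  -- A leaf is joined to both sides at its position and a twist keeps positions, so only circuit
  -- edges need a hypothesis.
  twistᵛ-edge : ∀ {C C′ : Rel (Fin M) 0ℓ} t t′ → (∀ {x y} → C x y → C′ (twist t x) (twist t′ y)) →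
    ∀ {u v} → ClawEdge n C u v → ClawEdge n C′ (twistᵛ t u) (twistᵛ t′ v)
  twistᵛ-edge t t′ f (circuit-circuit c) = circuit-circuit (f c)
  twistᵛ-edge t t′ f (centre-leaf i j)   = centre-leaf i j
  twistᵛ-edge {C′ = C′} t t′ f (leaf-circuit i j) = subst (λ x → ClawEdge n C′ (leaf i j) (circuit x))
    (sym (trans (twist-ix t′ (position i j))
      (cong (λ k → ix n (k + (t′ + position i j) * N)) (m<n⇒m%n≡m (position<N i j)))))
    (leaf-side i j (t′ + position i j))
  twistᵛ-edge {C′ = C′} t t′ f (leaf-circuit′ i j) = subst (λ x → ClawEdge n C′ (leaf i j) (circuit x))
    (sym (trans (twist-ix t′ (position i j + N))
      (cong (λ k → ix n (k + (t′ + (position i j + N)) * N))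
        (trans ([m+n]%n≡m%n (position i j) N) (m<n⇒m%n≡m (position<N i j))))))
    (leaf-side i j (t′ + (position i j + N)))

  module _ (N-odd : parity N ≡ 1ℙ) where

    parity-sN : ∀ a s → parity (a + s * N) ≡ parity a ℙ.+ parity s
    parity-sN a s = begin
      parity (a + s * N)                   ≡⟨ ℙₚ.+-homo-+ a (s * N) ⟩
      parity a ℙ.+ parity (s * N)          ≡⟨ cong (parity a ℙ.+_) (ℙₚ.*-homo-* s N) ⟩
      parity a ℙ.+ (parity s ℙ.* parity N) ≡⟨ cong (λ p → parity a ℙ.+ (parity s ℙ.* p)) N-odd ⟩
      parity a ℙ.+ (parity s ℙ.* 1ℙ)       ≡⟨ cong (parity a ℙ.+_) (ℙₚ.*-identityʳ (parity s)) ⟩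
      parity a ℙ.+ parity s                ∎
      where open ≡-Reasoning

    -- The Chinese remainder theorem for odd `N`: parity and residue modulo `N` together fix the
    -- side.
    parity-divMod : ∀ m → parity m ≡ parity (m % N) ℙ.+ parity (m / N)
    parity-divMod m = trans (cong parity (m≡m%n+[m/n]*n m N)) (parity-sN (m % N) (m / N))

    -- For odd `N` the twist keeps the position `k` and adds `t + k` to the side modulo 2; doing so
    -- twice changes nothing.
    twist-involutive : ∀ t x → twist t (twist t x) ≡ x
    twist-involutive t x = begin
      twist t (ix n (k + a * N))                         ≡⟨ twist-ix t (k + a * N) ⟩
      ix n ((k + a * N) % N + (t + (k + a * N)) * N)
        ≡⟨ cong (λ r → ix n (r + (t + (k + a * N)) * N)) ([k+sN]%N≡k a (m%n<n m N)) ⟩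
      ix n (k + (t + (k + a * N)) * N)                   ≡⟨ ix-side k (t + (k + a * N)) (m / N) sides ⟩
      ix n (k + (m / N) * N)                             ≡⟨ cong (ix n) (m≡m%n+[m/n]*n m N) ⟨
      ix n m                                             ≡⟨ ix-toℕ x ⟩
      x                                                  ∎
      where
      open ≡-Reasoning
      m = toℕ x
      k = m % N
      a = t + m

      cancel : ∀ p q r → p ℙ.+ (q ℙ.+ (p ℙ.+ (q ℙ.+ r))) ≡ r
      cancel 0ℙ 0ℙ r = refl
      cancel 0ℙ 1ℙ r = ℙₚ.⁻¹-involutive r
      cancel 1ℙ 0ℙ r = ℙₚ.⁻¹-involutive r
      cancel 1ℙ 1ℙ r = trans (ℙₚ.⁻¹-involutive _) (ℙₚ.⁻¹-involutive r)

      sides : parity (t + (k + a * N)) ≡ parity (m / N)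
      sides = begin
        parity (t + (k + a * N))                          ≡⟨ ℙₚ.+-homo-+ t _ ⟩
        parity t ℙ.+ parity (k + a * N)                   ≡⟨ cong (parity t ℙ.+_) (parity-sN k a) ⟩
        parity t ℙ.+ (parity k ℙ.+ parity a)
          ≡⟨ cong (λ p → parity t ℙ.+ (parity k ℙ.+ p)) (ℙₚ.+-homo-+ t m) ⟩
        parity t ℙ.+ (parity k ℙ.+ (parity t ℙ.+ parity m))
          ≡⟨ cong (λ p → parity t ℙ.+ (parity k ℙ.+ (parity t ℙ.+ p))) (parity-divMod m) ⟩
        parity t ℙ.+ (parity k ℙ.+ (parity t ℙ.+ (parity k ℙ.+ parity (m / N))))
          ≡⟨ cancel (parity t) (parity k) (parity (m / N)) ⟩
        parity (m / N)                                    ∎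

    -- Writing `suc k = r + q * N`, the vertex after `k + a * N` on the long cycle has position `r`
    -- on side `q + a`. Since `N` is odd, `r` has the parity of `suc k + q`, and `t′` contributes
    -- the other successor, so the sides agree even when `suc k` wraps.
    twist-two⇒one : ∀ t t′ → parity t′ ≡ parity (suc t) →
      ∀ {x y} → TwoCycles n x y → OneCycle n (twist t x) (twist t′ y)
    twist-two⇒one t t′ t′≡1+t c with view k s k<N _ ← twoCycles-view c = subst₂ (OneCycle n)
      (sym (trans (twist-ix t (k + s * N))
        (cong (λ r → ix n (r + a * N)) ([k+sN]%N≡k s k<N))))
      (sym (begin
        twist t′ (ix n (r + s * N))                      ≡⟨ twist-ix t′ (r + s * N) ⟩
        ix n ((r + s * N) % N + (t′ + (r + s * N)) * N)
          ≡⟨ cong (λ r′ → ix n (r′ + (t′ + (r + s * N)) * N)) ([k+sN]%N≡k s (m%n<n (suc k) N)) ⟩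
        ix n (r + (t′ + (r + s * N)) * N)                ≡⟨ ix-side r (t′ + (r + s * N)) (q + a) sides ⟩
        ix n (r + (q + a) * N)                           ≡⟨ cong (λ b → ix n (r + b)) (*-distribʳ-+ N q a) ⟩
        ix n (r + (q * N + a * N))                       ≡⟨ cong (ix n) (+-assoc r (q * N) (a * N)) ⟨
        ix n (r + q * N + a * N)
          ≡⟨ cong (λ b → ix n (b + a * N)) (m≡m%n+[m/n]*n (suc k) N) ⟨
        ix n (suc k + a * N)                             ∎))
      (oneCycle-step (k + a * N))
      where
      open ≡-Reasoning
      r = suc k % N
      q = suc k / N
      a = t + (k + s * N)

      balance : ∀ p o w z → p ⁻¹ ℙ.+ (o ℙ.+ z) ≡ w ℙ.+ (p ℙ.+ ((o ℙ.+ w) ⁻¹ ℙ.+ z))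
      balance 0ℙ 0ℙ 0ℙ z = refl
      balance 0ℙ 0ℙ 1ℙ z = refl
      balance 0ℙ 1ℙ 0ℙ z = ℙₚ.⁻¹-involutive z
      balance 0ℙ 1ℙ 1ℙ z = refl
      balance 1ℙ 0ℙ 0ℙ z = sym (ℙₚ.⁻¹-involutive z)
      balance 1ℙ 0ℙ 1ℙ z = sym (ℙₚ.⁻¹-involutive z)
      balance 1ℙ 1ℙ 0ℙ z = refl
      balance 1ℙ 1ℙ 1ℙ z = sym (cong _⁻¹ (ℙₚ.⁻¹-involutive z))

      parity-k : parity k ≡ (parity r ℙ.+ parity q) ⁻¹
      parity-k = trans (sym (ℙₚ.suc-homo-⁻¹ k)) (cong _⁻¹ (parity-divMod (suc k)))

      sides : parity (t′ + (r + s * N)) ≡ parity (q + a)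
      sides = begin
        parity (t′ + (r + s * N))                        ≡⟨ ℙₚ.+-homo-+ t′ _ ⟩
        parity t′ ℙ.+ parity (r + s * N)
          ≡⟨ cong₂ ℙ._+_ (trans t′≡1+t (parity-suc t)) (parity-sN r s) ⟩
        parity t ⁻¹ ℙ.+ (parity r ℙ.+ parity s)
          ≡⟨ balance (parity t) (parity r) (parity q) (parity s) ⟩
        parity q ℙ.+ (parity t ℙ.+ ((parity r ℙ.+ parity q) ⁻¹ ℙ.+ parity s))
          ≡⟨ cong (λ p → parity q ℙ.+ (parity t ℙ.+ (p ℙ.+ parity s))) parity-k ⟨
        parity q ℙ.+ (parity t ℙ.+ (parity k ℙ.+ parity s))
          ≡⟨ cong (λ p → parity q ℙ.+ (parity t ℙ.+ p)) (parity-sN k s) ⟨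
        parity q ℙ.+ (parity t ℙ.+ parity (k + s * N))   ≡⟨ cong (parity q ℙ.+_) (ℙₚ.+-homo-+ t _) ⟨
        parity q ℙ.+ parity a                            ≡⟨ ℙₚ.+-homo-+ q a ⟨
        parity (q + a)                                   ∎

    twistᵛ-involutive : ∀ t v → twistᵛ t (twistᵛ t v) ≡ v
    twistᵛ-involutive t (circuit x) = cong circuit (twist-involutive t x)
    twistᵛ-involutive t (centre i)  = refl
    twistᵛ-involutive t (leaf i j)  = refl

    twistᵛ-injective : ∀ t {u v} → twistᵛ t u ≡ twistᵛ t v → u ≡ v
    twistᵛ-injective t {u} {v} eq =
      trans (sym (twistᵛ-involutive t u)) (trans (cong (twistᵛ t) eq) (twistᵛ-involutive t v))

    twistᵛ-bijection : ℕ → ClawVertex n ⤖ ClawVertex n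
    twistᵛ-bijection t = mk⤖ (twistᵛ-injective t ,
      strictlySurjective⇒surjective (λ v → twistᵛ t v , twistᵛ-involutive t v))

    twistᵛ-CG⇒CG′ : ∀ {u v} → Arc (CG n) u v → Arc (CG′ n) (twistᵛ 0 u) (twistᵛ 1 v)
    twistᵛ-CG⇒CG′ (fwd e) = fwd (twistᵛ-edge 0 1 (twist-one⇒two 0 1 refl) e)
    twistᵛ-CG⇒CG′ (bwd e) = bwd (twistᵛ-edge 1 0 (twist-one⇒two 1 0 refl) e)

    twistᵛ-CG′⇒CG : ∀ {u v} → Arc (CG′ n) u v → Arc (CG n) (twistᵛ 0 u) (twistᵛ 1 v)
    twistᵛ-CG′⇒CG (fwd e) = fwd (twistᵛ-edge 0 1 (twist-two⇒one 0 1 refl) e)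
    twistᵛ-CG′⇒CG (bwd e) = bwd (twistᵛ-edge 1 0 (twist-two⇒one 1 0 refl) e)

    CG-TFIsomorphic-CG′ : TFIsomorphic (CG n) (CG′ n)
    CG-TFIsomorphic-CG′ = twistᵛ-bijection 0 , twistᵛ-bijection 1 , λ u v →
      mk⇔ twistᵛ-CG⇒CG′
        -- An arc between images is twisted again; the twists are involutions, so its ends become
        -- `u` and `v`.
        (subst₂ (Arc (CG n)) (twistᵛ-involutive 0 u) (twistᵛ-involutive 1 v) ∘ twistᵛ-CG′⇒CG)

  -- Triangles and hexagons in the claw graph

  -- What an arc implies, computed from the kinds of its ends, so that pattern matching refutes
  -- impossible arcs.
  Adjacent : ClawVertex n → ClawVertex n → Set
  Adjacent (circuit x) (circuit y)   = y ≡ next x ⊎ x ≡ next y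
  Adjacent (circuit x) (leaf i j)    = toℕ x % N ≡ position i j
  Adjacent (leaf i j)  (circuit x)   = toℕ x % N ≡ position i j
  Adjacent (leaf i j)  (centre i′)   = i ≡ i′
  Adjacent (centre i)  (leaf i′ j)   = i ≡ i′
  Adjacent _           _             = ⊥

  arc⇒adjacent : ∀ {u v} → Arc (CG n) u v → Adjacent u v
  arc⇒adjacent (fwd (circuit-circuit c))   = inj₁ (oneCycle⇒next c)
  arc⇒adjacent (bwd (circuit-circuit c))   = inj₂ (oneCycle⇒next c)
  arc⇒adjacent (fwd (centre-leaf i j))     = refl
  arc⇒adjacent (bwd (centre-leaf i j))     = refl
  arc⇒adjacent (fwd e@(leaf-circuit i j))  = leaf-circuit-%N e
  arc⇒adjacent (bwd e@(leaf-circuit i j))  = leaf-circuit-%N e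
  arc⇒adjacent (fwd e@(leaf-circuit′ i j)) = leaf-circuit-%N e
  arc⇒adjacent (bwd e@(leaf-circuit′ i j)) = leaf-circuit-%N e

  next-%N-≢ : ∀ x → toℕ (next x) % N ≢ toℕ x % N
  next-%N-≢ x eq = >⇒∤ 1<N ([k+m]%d≡m%d⇒d∣k 1 (toℕ x) N (trans (sym (next-%N x)) eq))

  -- Circuit edges flip parity, which excludes three circuit vertices. The circuit neighbours of a
  -- leaf agree modulo `N`, whereas consecutive circuit vertices do not. Every other triple lacks an
  -- arc.
  CG-triangleFree : TriangleFree (CG n)
  CG-triangleFree uv vw wu = no-triangle _ _ _ (arc⇒adjacent uv) (arc⇒adjacent vw) (arc⇒adjacent wu)
    where
    adjacent-%N : ∀ {x y} → Adjacent (circuit x) (circuit y) → toℕ x % N ≢ toℕ y % N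
    adjacent-%N (inj₁ refl) eq = next-%N-≢ _ (sym eq)
    adjacent-%N (inj₂ refl) eq = next-%N-≢ _ eq

    adjacent-parity : ∀ {x y} → Adjacent (circuit x) (circuit y) → parity (toℕ y) ≡ parity (toℕ x) ⁻¹
    adjacent-parity {x} (inj₁ refl) = parity-next x
    adjacent-parity {y = y} (inj₂ refl) =
      sym (trans (cong _⁻¹ (parity-next y)) (ℙₚ.⁻¹-involutive _))

    no-triangle : ∀ u v w → Adjacent u v → Adjacent v w → Adjacent w u → ⊥
    no-triangle (circuit x) (circuit y) (circuit z) a b c = ℙₚ.p≢p⁻¹ (parity (toℕ x)) (begin
      parity (toℕ x)               ≡⟨ adjacent-parity {z} {x} c ⟩
      parity (toℕ z) ⁻¹            ≡⟨ cong _⁻¹ (adjacent-parity {y} {z} b) ⟩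
      (parity (toℕ y) ⁻¹) ⁻¹       ≡⟨ ℙₚ.⁻¹-involutive _ ⟩
      parity (toℕ y)               ≡⟨ adjacent-parity {x} {y} a ⟩
      parity (toℕ x) ⁻¹            ∎)
      where open ≡-Reasoning
    no-triangle (circuit x) (circuit y) (leaf _ _)  a b c = adjacent-%N {x} {y} a (trans c (sym b))
    no-triangle (circuit x) (leaf _ _)  (circuit z) a b c = adjacent-%N {z} {x} c (trans b (sym a))
    no-triangle (leaf _ _)  (circuit y) (circuit z) a b c = adjacent-%N {y} {z} b (trans a (sym c))
    no-triangle (circuit _) (leaf _ _) (centre _) a b ()
    no-triangle (circuit _) (leaf _ _) (leaf _ _) a () c
    no-triangle (leaf _ _) (circuit _) (leaf _ _) a b ()
    no-triangle (leaf _ _) (circuit _) (centre _) a () c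
    no-triangle (leaf _ _) (centre _) (leaf _ _) a b ()
    no-triangle (leaf _ _) (leaf _ _) _ () b c
    no-triangle (centre _) (leaf _ _) (leaf _ _) a () c
    no-triangle (centre _) (leaf _ _) (circuit _) a b ()
    no-triangle (centre _) (leaf _ _) (centre _) a b ()

  -- A hexagon through a centre would use two circuit vertices of different positions congruent
  -- mod n, joined by a circuit path of length 2.
  centre-not-on-hexagon : 3 ≤ n → ∀ {i} → ¬ Hexagon (CG n) (centre i)
  centre-not-on-hexagon 3≤n {i} hex = no-hexagon _ _ _ _ _
    (arc⇒adjacent arc₀₁) (arc⇒adjacent arc₁₂) (arc⇒adjacent arc₂₃)
    (arc⇒adjacent arc₃₄) (arc⇒adjacent arc₄₅) (arc⇒adjacent arc₅₀)
    w₀≢w₂ w₀≢w₄ w₁≢w₃ w₂≢w₄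
    where
    open Hexagon hex
    residue : ∀ {x} i′ j → toℕ x % N ≡ position i′ j → toℕ x % n ≡ toℕ i′
    residue {x} i′ j eq = begin
      toℕ x % n                    ≡⟨ m∣n⇒o%n%m≡o%m n N (toℕ x) n∣N ⟨
      toℕ x % N % n                ≡⟨ cong (_% n) eq ⟩
      (toℕ i′ + toℕ j * n) % n     ≡⟨ [m+kn]%n≡m%n (toℕ i′) (toℕ j) n ⟩
      toℕ i′ % n                   ≡⟨ m<n⇒m%n≡m (toℕ<n i′) ⟩
      toℕ i′                       ∎
      where open ≡-Reasoning

    next-%n : ∀ x → toℕ (next x) % n ≡ suc (toℕ x) % n
    next-%n x = trans (sym (m∣n⇒o%n%m≡o%m n N (toℕ (next x)) n∣N))
      (trans (cong (_% n) (next-%N x)) (m∣n⇒o%n%m≡o%m n N (suc (toℕ x)) n∣N))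

    next²-%n-≢ : ∀ x → toℕ (next (next x)) % n ≢ toℕ x % n
    next²-%n-≢ x eq = >⇒∤ 3≤n ([k+m]%d≡m%d⇒d∣k 2 (toℕ x) n (begin
      (2 + toℕ x) % n                 ≡⟨ %-absorbʳ 1 (suc (toℕ x)) n ⟨
      suc (suc (toℕ x) % n) % n       ≡⟨ cong (λ r → suc r % n) (next-%n x) ⟨
      suc (toℕ (next x) % n) % n      ≡⟨ %-absorbʳ 1 (toℕ (next x)) n ⟩
      suc (toℕ (next x)) % n          ≡⟨ next-%n (next x) ⟨
      toℕ (next (next x)) % n         ≡⟨ eq ⟩
      toℕ x % n                       ∎))
      where open ≡-Reasoning

    no-hexagon : ∀ w₁ w₂ w₃ w₄ w₅ →
      Adjacent (centre i) w₁ → Adjacent w₁ w₂ → Adjacent w₂ w₃ → Adjacent w₃ w₄ →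
      Adjacent w₄ w₅ → Adjacent w₅ (centre i) →
      centre i ≢ w₂ → centre i ≢ w₄ → w₁ ≢ w₃ → w₂ ≢ w₄ → ⊥
    no-hexagon (leaf _ _) (centre _) _ _ _ refl refl _ _ _ _ w₀≢w₂ _ _ _ = w₀≢w₂ refl
    no-hexagon (leaf _ _) (circuit x) (leaf _ _) _ _ _ a b _ _ _ _ _ w₁≢w₃ _ =
      w₁≢w₃ (position-injective (trans (sym a) b))
    no-hexagon (leaf _ _) (circuit _) (circuit _) (centre _) _ _ _ _ () _ _ _ _ _ _
    no-hexagon (leaf _ _) (circuit _) (circuit _) (leaf _ _) (centre _) _ _ _ _ _ () _ _ _ _
    no-hexagon (leaf _ _) (circuit _) (circuit _) (leaf _ _) (circuit _) _ _ _ _ _ () _ _ _ _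
    no-hexagon (leaf _ _) (circuit _) (circuit _) (leaf _ _) (leaf _ _) _ _ _ _ () _ _ _ _ _
    -- Here `x`, `y`, `z` is a circuit walk. Turning back at `y` contradicts `w₂≢w₄`. Otherwise the
    -- ends differ by 2 modulo `n`, although both neighbour leaves of the same centre; this is where
    -- `3 ≤ n` enters.
    no-hexagon (leaf i₁ j₁) (circuit x) (circuit y) (circuit z) (leaf i₅ j₅)
      i≡i₁ a b c d i₅≡i _ _ _ w₂≢w₄ = case (b , c) of λ where
        (inj₁ refl , inj₁ refl) → next²-%n-≢ x (sym same)
        (inj₁ refl , inj₂ e)    → w₂≢w₄ (cong circuit (next-injective e))
        (inj₂ refl , inj₁ refl) → w₂≢w₄ refl
        (inj₂ refl , inj₂ refl) → next²-%n-≢ z same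
      where
      same : toℕ x % n ≡ toℕ z % n
      same = trans (residue i₁ j₁ a)
        (trans (cong toℕ (sym (trans i₅≡i i≡i₁))) (sym (residue i₅ j₅ d)))

  NonCentre : ClawVertex n → Set
  NonCentre (centre _) = ⊥
  NonCentre _          = ⊤

  antipode-≢ : ∀ m → circuit {n} (ix n (m + 0 * N)) ≢ circuit (ix n (m + 1 * N))
  antipode-≢ m eq = >⇒∤ N<M ([k+m]%d≡m%d⇒d∣k N m M (begin
    (N + m) % M                    ≡⟨ cong (_% M) (+-comm N m) ⟩
    (m + N) % M                    ≡⟨ cong (λ d → (m + d) % M) (*-identityˡ N) ⟨
    (m + 1 * N) % M                ≡⟨ toℕ-ix (m + 1 * N) ⟨
    toℕ (ix n (m + 1 * N))         ≡⟨ cong toℕ (circuit-injective eq) ⟨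
    toℕ (ix n (m + 0 * N))         ≡⟨ toℕ-ix (m + 0 * N) ⟩
    (m + 0 * N) % M                ≡⟨ cong (_% M) (+-identityʳ m) ⟩
    m % M                          ∎))
    where
    open ≡-Reasoning

  -- Consecutive rungs u_m – leaf – u_{m+3n} bound a hexagon.
  nonCentre-on-hexagon : ∀ v → NonCentre v → Hexagon (CG n) v
  nonCentre-on-hexagon (leaf i j) _ with _ , _ , e′ ← leaf-at {OneCycle n} (suc (position i j)) = record
    { arc₀₁ = fwd (leaf-side i j 0)
    ; arc₁₂ = fwd (circuit-circuit (oneCycle-step (position i j + 0 * N)))
    ; arc₂₃ = bwd (e′ 0)
    ; arc₃₄ = fwd (e′ 1)
    ; arc₄₅ = bwd (circuit-circuit (oneCycle-step (position i j + 1 * N)))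
    ; arc₅₀ = bwd (leaf-side i j 1)
    ; w₀≢w₂ = λ ()
    ; w₀≢w₄ = λ ()
    ; w₁≢w₃ = λ ()
    ; w₂≢w₄ = antipode-≢ (suc (position i j))
    }
  nonCentre-on-hexagon (circuit x) _
    with _ , _ , e ← leaf-at {OneCycle n} (toℕ x)
       | _ , _ , e′ ← leaf-at {OneCycle n} (suc (toℕ x)) =
    subst (Hexagon (CG n) ∘ circuit) (trans (cong (ix n) (+-identityʳ (toℕ x))) (ix-toℕ x)) record
    { arc₀₁ = fwd (circuit-circuit (oneCycle-step (toℕ x + 0 * N)))
    ; arc₁₂ = bwd (e′ 0)
    ; arc₂₃ = fwd (e′ 1)
    ; arc₃₄ = bwd (circuit-circuit (oneCycle-step (toℕ x + 1 * N)))
    ; arc₄₅ = bwd (e 1)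
    ; arc₅₀ = fwd (e 0)
    ; w₀≢w₂ = λ ()
    ; w₀≢w₄ = antipode-≢ (toℕ x)
    ; w₁≢w₃ = antipode-≢ (suc (toℕ x))
    ; w₂≢w₄ = λ ()
    }

  -- Connectedness and 2-colourings for even n

  CG-connected : Connected (CG n)
  CG-connected f f-const u v = trans (at-0 u) (sym (at-0 v))
    where
    on-circuit : ∀ m → f (circuit (ix n m)) ≡ f (circuit (ix n 0))
    on-circuit zero    = refl
    on-circuit (suc m) = trans (sym (f-const (fwd (circuit-circuit (oneCycle-step m))))) (on-circuit m)

    at-0 : ∀ v → f v ≡ f (circuit (ix n 0))
    at-0 (circuit x) = trans (cong (f ∘ circuit) (sym (ix-toℕ x))) (on-circuit (toℕ x))
    at-0 (leaf i j)  = trans (f-const (fwd (leaf-circuit i j))) (on-circuit (position i j))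
    at-0 (centre i)  = trans (f-const (fwd (centre-leaf i zero))) (at-0 (leaf i zero))

  -- For even `n` this colours both graphs properly: the circuit neighbours of the leaves at centre
  -- `i` all have the parity of `i`.
  colour : ClawVertex n → Parity
  colour (circuit x) = parity (toℕ x)
  colour (leaf i j)  = parity (toℕ i) ⁻¹
  colour (centre i)  = parity (toℕ i)

  module _ (n-even : parity n ≡ 0ℙ) where

    N-even : parity N ≡ 0ℙ
    N-even = trans (ℙₚ.*-homo-* 3 n) n-even

    oneCycle-parity : ∀ {x y} → OneCycle n x y → parity (toℕ y) ≡ parity (toℕ x) ⁻¹
    oneCycle-parity {x} c with refl ← oneCycle⇒next c = parity-next x

    -- As `N` is even, neither wrapping around a short cycle nor the choice of side affects parity.
    twoCycles-parity : ∀ {x y} → TwoCycles n x y → parity (toℕ y) ≡ parity (toℕ x) ⁻¹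
    twoCycles-parity c with view k s _ _ ← twoCycles-view c = begin
      parity (toℕ (ix n (suc k % N + s * N)))     ≡⟨ parity-ix (suc k % N + s * N) ⟩
      parity (suc k % N + s * N)                  ≡⟨ parity-+s*even (suc k % N) s {N} N-even ⟩
      parity (suc k % N)                          ≡⟨ parity-% (suc k) {N} N-even ⟩
      parity (suc k)                              ≡⟨ parity-suc k ⟩
      parity k ⁻¹                                 ≡⟨ cong _⁻¹ (parity-+s*even k s {N} N-even) ⟨
      parity (k + s * N) ⁻¹                       ≡⟨ cong _⁻¹ (parity-ix (k + s * N)) ⟨
      parity (toℕ (ix n (k + s * N))) ⁻¹          ∎
      where open ≡-Reasoning

    colour-edge : ∀ {C : Rel (Fin M) 0ℓ} → (∀ {x y} → C x y → parity (toℕ y) ≡ parity (toℕ x) ⁻¹) →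
      ∀ {u v} → ClawEdge n C u v → colour v ≡ colour u ⁻¹
    colour-edge C-parity (circuit-circuit c) = C-parity c
    colour-edge C-parity (centre-leaf i j)   = refl
    colour-edge C-parity (leaf-circuit i j)  = begin
      parity (toℕ (ix n (position i j)))  ≡⟨ parity-ix (position i j) ⟩
      parity (position i j)               ≡⟨ parity-+s*even (toℕ i) (toℕ j) {n} n-even ⟩
      parity (toℕ i)                      ≡⟨ ℙₚ.⁻¹-involutive _ ⟨
      (parity (toℕ i) ⁻¹) ⁻¹              ∎
      where open ≡-Reasoning
    colour-edge C-parity (leaf-circuit′ i j) = begin
      parity (toℕ (ix n (position i j + N)))  ≡⟨ parity-ix (position i j + N) ⟩
      parity (position i j + N)               ≡⟨ cong (λ d → parity (position i j + d)) (*-identityˡ N) ⟨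
      parity (position i j + 1 * N)           ≡⟨ parity-+s*even (position i j) 1 {N} N-even ⟩
      parity (position i j)                   ≡⟨ parity-+s*even (toℕ i) (toℕ j) {n} n-even ⟩
      parity (toℕ i)                          ≡⟨ ℙₚ.⁻¹-involutive _ ⟨
      (parity (toℕ i) ⁻¹) ⁻¹                  ∎
      where open ≡-Reasoning

    colour-arc : ∀ {C : Rel (Fin M) 0ℓ} → (∀ {x y} → C x y → parity (toℕ y) ≡ parity (toℕ x) ⁻¹) →
      ∀ {u v} → SymClosure (ClawEdge n C) u v → colour v ≡ colour u ⁻¹
    colour-arc C-parity (fwd e) = colour-edge C-parity e
    colour-arc C-parity (bwd e) =
      sym (trans (cong _⁻¹ (colour-edge C-parity e)) (ℙₚ.⁻¹-involutive _))

    even⇒¬TFCousins : ¬ TFCousins (CG n) (CG′ n)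
    even⇒¬TFCousins (tf , ¬iso) = ¬iso (bipartite-TF⇒iso {CG n} {CG′ n}
      (colour-arc oneCycle-parity) (colour-arc twoCycles-parity) CG-connected
      (_ , _ , fwd (circuit-circuit (oneCycle-step 0))) tf)

  -- Non-isomorphism for odd n

  arc-side : ∀ {x y} → Arc (CG′ n) (circuit x) (circuit y) → side x ≡ side y
  arc-side (fwd (circuit-circuit c)) = twoCycles-side c
  arc-side (bwd (circuit-circuit c)) = sym (twoCycles-side c)

  -- The image of the 6n-cycle would stay within one of the two 3n-cycles.
  oneCycle↛twoCycles : ∀ (ψ : Fin M → Fin M) → (∀ {x y} → ψ x ≡ ψ y → x ≡ y) →
    ¬ (∀ {x y} → OneCycle n x y → Arc (CG′ n) (circuit (ψ x)) (circuit (ψ y)))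
  oneCycle↛twoCycles ψ ψ-injective ψ-arc =
    -- All `M` images lie on one side, where a vertex is determined by its residue modulo `N`; there
    -- are only `N` residues.
    let _ , _ , i<j , eq = pigeonhole N<M (λ x → toℕ (ψ x) mod N)
    in <⇒≢ i<j (ψ-%N-injective eq)
    where
    ψ-side : ∀ m → side (ψ (ix n m)) ≡ side (ψ (ix n 0))
    ψ-side zero    = refl
    ψ-side (suc m) = trans (sym (arc-side (ψ-arc (oneCycle-step m)))) (ψ-side m)

    ψ-%N-injective : ∀ {x y} → toℕ (ψ x) mod N ≡ toℕ (ψ y) mod N → x ≡ y
    ψ-%N-injective {x} {y} eq = ψ-injective (toℕ-injective (begin
      toℕ (ψ x)                            ≡⟨ m≡m%n+[m/n]*n (toℕ (ψ x)) N ⟩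
      toℕ (ψ x) % N + side (ψ x) * N       ≡⟨ cong₂ (λ r s → r + s * N) same-% same-side ⟩
      toℕ (ψ y) % N + side (ψ y) * N       ≡⟨ m≡m%n+[m/n]*n (toℕ (ψ y)) N ⟨
      toℕ (ψ y)                            ∎))
      where
      open ≡-Reasoning
      same-% : toℕ (ψ x) % N ≡ toℕ (ψ y) % N
      same-% = trans (sym (toℕ-fromℕ< (m%n<n (toℕ (ψ x)) N)))
        (trans (cong toℕ eq) (toℕ-fromℕ< (m%n<n (toℕ (ψ y)) N)))

      side-0 : ∀ z → side (ψ z) ≡ side (ψ (ix n 0))
      side-0 z = trans (cong (side ∘ ψ) (sym (ix-toℕ z))) (ψ-side (toℕ z))

      same-side : side (ψ x) ≡ side (ψ y)
      same-side = trans (side-0 x) (sym (side-0 y))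

  module _ (N-odd : parity N ≡ 1ℙ) (3≤n : 3 ≤ n) (iso : Isomorphic (CG n) (CG′ n)) where

    private
      φ : ClawVertex n → ClawVertex n
      φ = to (proj₁ iso)

      φ-injective : ∀ {u v} → φ u ≡ φ v → u ≡ v
      φ-injective = injective (proj₁ iso)

      φ-arc : ∀ {u v} → Arc (CG n) u v → Arc (CG′ n) (φ u) (φ v)
      φ-arc = Equivalence.to (proj₂ iso _ _)

    -- A hexagon through `v` is carried by `φ` into the companion and by the alternating twists back
    -- into the claw graph. Twists fix centres, so if `φ v` were a centre, a hexagon of the claw
    -- graph would pass through it.
    φ-nonCentre : ∀ v → NonCentre v → NonCentre (φ v)
    φ-nonCentre v nc with φ v | hexagon-map {CG n} {CG n} (twistᵛ 0 ∘ φ) (twistᵛ 1 ∘ φ)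
      (φ-injective ∘ twistᵛ-injective N-odd 0) (φ-injective ∘ twistᵛ-injective N-odd 1)
      (twistᵛ-CG′⇒CG N-odd ∘ φ-arc) (nonCentre-on-hexagon v nc)
    ... | centre _  | hex = centre-not-on-hexagon 3≤n hex
    ... | circuit _ | _   = tt
    ... | leaf _ _  | _   = tt

    -- A leaf is adjacent to a centre, whereas all vertices adjacent to a circuit vertex are
    -- mapped to non-centres.
    φ-circuit : ∀ x → ∃[ y ] φ (circuit x) ≡ circuit y
    φ-circuit x with φ (circuit x) in eq | φ-nonCentre (circuit x) tt
    ... | circuit y | _ = y , refl
    ... | leaf i j  | _ with w , φw≡c ← strictlySurjective (proj₁ iso) (centre i) =
      ⊥-elim (subst NonCentre φw≡c (φ-nonCentre w (neighbour-nonCentre w (arc⇒adjacent arc))))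
      where
      arc : Arc (CG n) (circuit x) w
      arc = Equivalence.from (proj₂ iso _ _)
        (subst₂ (Arc (CG′ n)) (sym eq) (sym φw≡c) (bwd (centre-leaf i j)))

      neighbour-nonCentre : ∀ v → Adjacent (circuit x) v → NonCentre v
      neighbour-nonCentre (circuit _) _ = tt
      neighbour-nonCentre (leaf _ _)  _ = tt

    ψ : Fin M → Fin M
    ψ x = proj₁ (φ-circuit x)

    ψ-injective : ∀ {x y} → ψ x ≡ ψ y → x ≡ y
    ψ-injective {x} {y} eq = circuit-injective (φ-injective
      (trans (proj₂ (φ-circuit x)) (trans (cong circuit eq) (sym (proj₂ (φ-circuit y))))))

    odd∧3≤n⇒¬iso : ⊥
    odd∧3≤n⇒¬iso = oneCycle↛twoCycles ψ ψ-injective λ {x} {y} c →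
      subst₂ (Arc (CG′ n)) (proj₂ (φ-circuit x)) (proj₂ (φ-circuit y)) (φ-arc (fwd (circuit-circuit c)))

-- The case n = 1 and the equivalence

-- The short cycles are triangles here; an isomorphism would pull `u₀ u₁ u₂` back to a triangle of
-- `CG 1`.
CG1≇CG′1 : ¬ Isomorphic (CG 1) (CG′ 1)
CG1≇CG′1 (φ , arcs)
  with u , eu ← strictlySurjective φ (circuit (# 0))
     | v , ev ← strictlySurjective φ (circuit (# 1))
     | w , ew ← strictlySurjective φ (circuit (# 2)) =
  CG-triangleFree 1
    (pull (subst₂ (Arc (CG′ 1)) (sym eu) (sym ev) (fwd (circuit-circuit (step₁ 0 (s≤s z≤n))))))
    (pull (subst₂ (Arc (CG′ 1)) (sym ev) (sym ew) (fwd (circuit-circuit (step₁ 1 (s≤s (s≤s z≤n)))))))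
    (pull (subst₂ (Arc (CG′ 1)) (sym ew) (sym eu) (fwd (circuit-circuit (step₁ 2 (s≤s (s≤s (s≤s z≤n))))))))
  where
  pull : ∀ {u v} → Arc (CG′ 1) (to φ u) (to φ v) → Arc (CG 1) u v
  pull = Equivalence.from (arcs _ _)

odd⇒¬Isomorphic : ∀ n .{{_ : NonZero n}} → parity n ≡ 1ℙ → ¬ Isomorphic (CG n) (CG′ n)
odd⇒¬Isomorphic 1 _ = CG1≇CG′1
-- The values 0 and 2 need no clause, since their parity computes to `0ℙ`; hence `3 ≤ n`.
odd⇒¬Isomorphic n@(suc (suc (suc _))) n-odd =
  odd∧3≤n⇒¬iso n (trans (ℙₚ.*-homo-* 3 n) n-odd) (s≤s (s≤s (s≤s z≤n)))

proposition6p1 : ∀ (n : ℕ) .{{_ : NonZero n}} → TFCousins (CG n) (CG′ n) ⇔ (2 ∤ n)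
proposition6p1 n = mk⇔
  (λ cousins 2∣n → even⇒¬TFCousins n (2∣⇒parity-0 2∣n) cousins)
  (λ 2∤n → CG-TFIsomorphic-CG′ n (trans (ℙₚ.*-homo-* 3 n) (2∤⇒parity-1 2∤n)) ,
           odd⇒¬Isomorphic n (2∤⇒parity-1 2∤n))
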